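{- Let $k\ge 1$ be an integer. There is a bijection between the large $(k,k)$-Fuss-Schröder paths of length $n$ and the $(n,k)$-valid forests, for each positive integer $n$, which preserves type. Furthermore, under this bijection, small paths correspond exactly to the $(n,k)$-valid forests in which the second tree is a single vertex, and paths ending with a diagonal step correspond exactly to the $(n,k)$-valid forests in which the first tree is a single vertex.
   Context: Paths. A large $(k,k)$-Fuss-Schröder path of length $n$ is a lattice path from $(0,0)$ to $(n,kn)$ using east steps $(1,0)$, north steps $(0,1)$ and diagonal steps $(1,1)$, which stays nonstrictly above the line $y=kx$, and such that each diagonal step goes from the line $y=kj+k-1$ to the line $y=kj+k$ for some integer $j$. It is small if no diagonal step touches the line $y=kx$. The type of a path is the partition whose parts are the lengths of the maximal runs of consecutive east steps. Forests. A rooted plane tree is a rooted tree in which each vertex has a linearly ordered list of children; a rooted plane forest is a linearly ordered list of rooted plane trees. The vertices of a rooted plane forest with $V$ vertices are labeled $0,1,\dots,V-1$ in pre-order (each vertex is labeled before its descendants, children's subtrees are processed in order, and the trees of the forest are processed in order). An $(n,k)$-valid forest is a rooted plane forest with $2+(k+1)n$ vertices and $(k+1)n$ edges such that: (1) it consists of two rooted plane trees (a first and a second one); (2) every vertex whose pre-order label $s$ satisfies $s\equiv 1\pmod{k+1}$ has either $0$ or $k+1$ children; (3) every vertex whose label $s$ satisfies $s\not\equiv 1\pmod{k+1}$ has $m(k+1)$ children for some nonnegative integer $m$. The type of an $(n,k)$-valid forest is the partition formed by all positive integers $m$ (with repetition) arising from vertices in category (3) with $m(k+1)$ children. -}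

module Defs where

open import Level using (0ℓ)
open import Data.List.Base using (List; []; _∷_; _++_; _∷ʳ_; length; map; filter; sum)
open import Data.List.Relation.Unary.All using (All)
open import Data.Nat.Base using (ℕ; zero; suc; _+_; _*_; _∸_; _≤_; _/_; _%_)
open import Data.Nat.Properties using (_≟_; _<?_)
open import Data.Product.Base using (∃; _×_; _,_; proj₁; proj₂)
open import Data.Sum.Base using (_⊎_)
open import Relation.Binary.Bundles using (Setoid)
open import Relation.Binary.PropositionalEquality using (_≡_; setoid)
open import Relation.Nullary.Decidable.Core using (¬?)
open import Relation.Nullary.Negation.Core using (¬_)
import Relation.Binary.Construct.On as On

data Step : Set where
  east north diagonal : Step

Point : Set
Point = ℕ × ℕ

origin : Point
origin = 0 , 0

move : Step → Point → Point
move east     (x , y) = suc x , y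
move north    (x , y) = x , suc y
move diagonal (x , y) = suc x , suc y

endpoint : Point → List Step → Point
endpoint p []      = p
endpoint p (s ∷ w) = endpoint (move s p) w

points : Point → List Step → List Point
points p []      = p ∷ []
points p (s ∷ w) = p ∷ points (move s p) w

diagonalStarts : Point → List Step → List Point
diagonalStarts p []             = []
diagonalStarts p (diagonal ∷ w) = p ∷ diagonalStarts (move diagonal p) w
diagonalStarts p (east     ∷ w) = diagonalStarts (move east p) w
diagonalStarts p (north    ∷ w) = diagonalStarts (move north p) w

OnLine : ℕ → Point → Set
OnLine k (x , y) = y ≡ k * x

-- It suffices to test lattice points: the region is convex.
WeaklyAbove : ℕ → Point → Set
WeaklyAbove k (x , y) = k * x ≤ y

-- The step starts on y = kj + k - 1 (and hence ends on y = kj + k).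
-- As the path has y ≥ 0 and k ≥ 1, an integer j is automatically natural.
AdmissibleDiagonalStart : ℕ → Point → Set
AdmissibleDiagonalStart k (x , y) = ∃ λ j → y ≡ k * j + (k ∸ 1)

record IsLargePath (k n : ℕ) (w : List Step) : Set where
  field
    ends      : endpoint origin w ≡ (n , k * n)
    above     : All (WeaklyAbove k) (points origin w)
    diagonals : All (AdmissibleDiagonalStart k) (diagonalStarts origin w)

-- A segment weakly above y = kx that touches this line does so at an endpoint.
DiagonalTouches : ℕ → Point → Set
DiagonalTouches k p = OnLine k p ⊎ OnLine k (move diagonal p)

IsSmall : ℕ → List Step → Set
IsSmall k w = All (λ p → ¬ DiagonalTouches k p) (diagonalStarts origin w)

EndsWithDiagonal : List Step → Set
EndsWithDiagonal w = ∃ λ v → w ≡ v ∷ʳ diagonal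

-- Lengths of the maximal runs of east steps, from left to right; the first
-- argument is the number of east steps read since the last other step.
eastRunsFrom : ℕ → List Step → List ℕ
eastRunsFrom r       (east     ∷ w) = eastRunsFrom (suc r) w
eastRunsFrom zero    []             = []
eastRunsFrom zero    (north    ∷ w) = eastRunsFrom zero w
eastRunsFrom zero    (diagonal ∷ w) = eastRunsFrom zero w
eastRunsFrom (suc r) []             = suc r ∷ []
eastRunsFrom (suc r) (north    ∷ w) = suc r ∷ eastRunsFrom zero w
eastRunsFrom (suc r) (diagonal ∷ w) = suc r ∷ eastRunsFrom zero w

-- A partition is represented by a list of its parts, in any order; equality
-- of partitions is then the permutation relation _↭_.
pathType : List Step → List ℕ
pathType = eastRunsFrom 0

-- Paths are equal when their step sequences are.
LargePaths : ℕ → ℕ → Setoid 0ℓ 0ℓ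
LargePaths k n = On.setoid {B = ∃ (IsLargePath k n)} (setoid (List Step)) proj₁

data Tree : Set where
  node : List Tree → Tree

Forest : Set
Forest = List Tree

children : Tree → List Tree
children (node ts) = ts

arity : Tree → ℕ
arity t = length (children t)

-- The vertices in pre-order, each given by the subtree rooted at it.
preorder : Forest → List Tree
preorder []             = []
preorder (node ts ∷ us) = node ts ∷ preorder ts ++ preorder us

labelFrom : {A : Set} → ℕ → List A → List (ℕ × A)
labelFrom s []       = []
labelFrom s (a ∷ as) = (s , a) ∷ labelFrom (suc s) as

labelled : Forest → List (ℕ × Tree)
labelled F = labelFrom 0 (preorder F)

vertexCount : Forest → ℕ
vertexCount F = length (preorder F)

edgeCount : Forest → ℕ
edgeCount F = sum (map arity (preorder F))

CongruentTo1 : ℕ → ℕ → Set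
CongruentTo1 k s = s % suc k ≡ 1 % suc k

record IsValidForest (k n : ℕ) (F : Forest) : Set where
  field
    vertices : vertexCount F ≡ 2 + suc k * n
    edges    : edgeCount F ≡ suc k * n
    twoTrees : length F ≡ 2
    label≡1  : All (λ (s , v) → CongruentTo1 k s → arity v ≡ 0 ⊎ arity v ≡ suc k)
                   (labelled F)
    label≢1  : All (λ (s , v) → ¬ CongruentTo1 k s → ∃ λ m → arity v ≡ m * suc k)
                   (labelled F)

-- The positive m such that a vertex with label ≢ 1 (mod k + 1) has m (k + 1)
-- children; on valid forests the division is exact.
forestType : ℕ → Forest → List ℕ
forestType k F =
  filter (0 <?_)
    (map (λ (s , v) → arity v / suc k)
      (filter (λ (s , v) → ¬? (s % suc k ≟ 1 % suc k)) (labelled F)))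

singleVertex : Tree
singleVertex = node []

FirstTreeIsSingleVertex : Forest → Set
FirstTreeIsSingleVertex F = ∃ λ t → F ≡ singleVertex ∷ t ∷ []

SecondTreeIsSingleVertex : Forest → Set
SecondTreeIsSingleVertex F = ∃ λ t → F ≡ t ∷ singleVertex ∷ []

-- Forests are equal when their underlying plane forests are.
ValidForests : ℕ → ℕ → Setoid 0ℓ 0ℓ
ValidForests k n = On.setoid {B = ∃ (IsValidForest k n)} (setoid Forest) proj₁

{-# OPTIONS --safe #-}
module Submission where

-- Read a path from left to right and cut it into slots: the number of east
-- steps at each height, and between the heights kj + k - 1 and kj + k one more
-- slot that is 1 for a diagonal step and 0 for a north step.  Put an extra 0
-- in front.  Multiplied by k + 1, the slots are the arities of the forest, in
-- reverse pre-order: a stack machine that pops a trees and pushes their common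
-- parent for each arity a builds the forest.  With k + 1 slots per k heights,
-- the stack never runs out exactly when the path stays above y = kx.
-- The bottom of the stack, finally the second tree, is the initial single
-- vertex until a diagonal step touching y = kx consumes the whole stack.

open import Defs
open import Data.List.Base using (List; []; _∷_; _++_; length; map; take; drop; last; filter)
open import Data.List.Properties
  using (length-map; map-++; map-injective; ++-assoc; ++-identityʳ; take++drop≡id; length-take; length-drop;
         filter-accept; filter-reject; ∷-injectiveˡ; ∷ʳ-injectiveʳ)
open import Data.List.Relation.Unary.All as All using (All; []; _∷_)
open import Data.List.Relation.Binary.Permutation.Propositional using (_↭_; ↭-reflexive; module PermutationReasoning)
open import Data.List.Relation.Binary.Permutation.Propositional.Properties using (++-comm; ++⁺ʳ)
open import Data.Maybe.Base using (just; maybe′)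
open import Data.Nat.Base
open import Data.Nat.DivMod
open import Data.Nat.ListAction using (sum)
open import Data.Nat.Properties
open import Data.Product.Base using (Σ; ∃; _×_; _,_; proj₁; proj₂; map₂; uncurry)
open import Data.Sum.Base using (_⊎_; inj₁; inj₂)
open import Function.Bundles using (Bijection; _⇔_; mk⇔)
open import Function.Properties.Equivalence using () renaming (sym to ⇔-sym; trans to infixr 9 _⟨∘⟩_)
open import Relation.Binary.Bundles using (Setoid)
open import Relation.Binary.PropositionalEquality
  using (_≡_; _≢_; refl; sym; trans; cong; cong₂; subst; subst₂; module ≡-Reasoning)
open import Relation.Nullary.Decidable.Core using (Dec; yes; no; ¬?)
open import Relation.Nullary.Negation.Core using (¬_; contradiction)
open import Algebra.Properties.CommutativeSemigroup +-commutativeSemigroup using (x∙yz≈y∙xz; x∙yz≈yx∙z)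

-- Forests and pre-order arities

arities : Forest → List ℕ
arities F = map arity (preorder F)

parse : List ℕ → Forest
parse []       = []
parse (a ∷ as) = node (take a (parse as)) ∷ drop a (parse as)

-- Luk h as: read from its end as pre-order arities, as leaves h trees on the
-- stack and never pops more trees than there are.
data Luk : ℕ → List ℕ → Set where
  []  : Luk 0 []
  _∷_ : ∀ {h as} a → Luk (a + h) as → Luk (suc h) (a ∷ as)

take-length-++ : {A : Set} (xs ys : List A) → take (length xs) (xs ++ ys) ≡ xs
take-length-++ []       ys = refl
take-length-++ (x ∷ xs) ys = cong (x ∷_) (take-length-++ xs ys)

drop-length-++ : {A : Set} (xs ys : List A) → drop (length xs) (xs ++ ys) ≡ ys
drop-length-++ []       ys = refl
drop-length-++ (x ∷ xs) ys = drop-length-++ xs ys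

preorder-++ : ∀ F G → preorder (F ++ G) ≡ preorder F ++ preorder G
preorder-++ []             G = refl
preorder-++ (node ts ∷ us) G = cong (node ts ∷_)
  (trans (cong (preorder ts ++_) (preorder-++ us G))
         (sym (++-assoc (preorder ts) (preorder us) (preorder G))))

arities-++ : ∀ F G → arities (F ++ G) ≡ arities F ++ arities G
arities-++ F G = trans (cong (map arity) (preorder-++ F G)) (map-++ arity (preorder F) (preorder G))

arities-node : ∀ ts us as → arities (node ts ∷ us) ++ as ≡ length ts ∷ arities ts ++ arities us ++ as
arities-node ts us as = cong (length ts ∷_)
  (trans (cong (_++ as) (map-++ arity (preorder ts) (preorder us)))
         (++-assoc (arities ts) (arities us) as))

-- Reading from the right pushes the later siblings first and then the children, which the root's
-- arity pops at once. The tail `as` accounts for what lies deeper in the stack.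
parse-arities-++ : ∀ F as → parse (arities F ++ as) ≡ F ++ parse as
parse-arities-++ []             as = refl
parse-arities-++ (node ts ∷ us) as = begin
  parse (arities (node ts ∷ us) ++ as)               ≡⟨ cong parse (arities-node ts us as) ⟩
  graft (parse (arities ts ++ arities us ++ as))     ≡⟨ cong graft (parse-arities-++ ts (arities us ++ as)) ⟩
  graft (ts ++ parse (arities us ++ as))             ≡⟨ cong (λ st → graft (ts ++ st)) (parse-arities-++ us as) ⟩
  graft (ts ++ us ++ parse as)                       ≡⟨ cong₂ (λ us vs → node us ∷ vs) (take-length-++ ts _) (drop-length-++ ts _) ⟩
  node ts ∷ us ++ parse as                           ∎
  where
  open ≡-Reasoning
  graft : Forest → Forest
  graft st = node (take (length ts) st) ∷ drop (length ts) st

parse-arities : ∀ F → parse (arities F) ≡ F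
parse-arities F = begin
  parse (arities F)       ≡⟨ cong parse (++-identityʳ (arities F)) ⟨
  parse (arities F ++ []) ≡⟨ parse-arities-++ F [] ⟩
  F ++ []                 ≡⟨ ++-identityʳ F ⟩
  F                       ∎
  where open ≡-Reasoning

length-parse : ∀ {h as} → Luk h as → length (parse as) ≡ h
length-parse []                        = refl
length-parse (_∷_ {h} {as} a L) = cong suc (begin
  length (drop a (parse as)) ≡⟨ length-drop a (parse as) ⟩
  length (parse as) ∸ a      ≡⟨ cong (_∸ a) (length-parse L) ⟩
  a + h ∸ a                  ≡⟨ m+n∸m≡n a h ⟩
  h                          ∎)
  where open ≡-Reasoning

root-arity : ∀ {h a as} → Luk (suc h) (a ∷ as) → length (take a (parse as)) ≡ a
root-arity {h} {a} {as} (a ∷ L) = begin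
  length (take a (parse as)) ≡⟨ length-take a (parse as) ⟩
  a ⊓ length (parse as)      ≡⟨ cong (a ⊓_) (length-parse L) ⟩
  a ⊓ (a + h)                ≡⟨ m≤n⇒m⊓n≡m (m≤m+n a h) ⟩
  a                          ∎
  where open ≡-Reasoning

-- `take` silently truncates on a short stack; `Luk` rules this out, so every vertex gets as many
-- children as its arity asks for.
arities-parse : ∀ {h as} → Luk h as → arities (parse as) ≡ as
arities-parse []                        = refl
arities-parse (_∷_ {h} {as} a L) = cong₂ _∷_ (root-arity (a ∷ L)) (begin
  map arity (preorder ts ++ preorder us) ≡⟨ map-++ arity (preorder ts) (preorder us) ⟩
  arities ts ++ arities us               ≡⟨ arities-++ ts us ⟨
  arities (ts ++ us)                     ≡⟨ cong arities (take++drop≡id a (parse as)) ⟩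
  arities (parse as)                     ≡⟨ arities-parse L ⟩
  as                                     ∎)
  where
  open ≡-Reasoning
  ts = take a (parse as)
  us = drop a (parse as)

arities-luk-++ : ∀ F {h as} → Luk h as → Luk (length F + h) (arities F ++ as)
arities-luk-++ []             L = L
arities-luk-++ (node ts ∷ us) {h} {as} L
  rewrite arities-node ts us as
  = length ts ∷ arities-luk-++ ts (arities-luk-++ us L)

arities-luk : ∀ F → Luk (length F) (arities F)
arities-luk F =
  subst₂ Luk (+-identityʳ (length F)) (++-identityʳ (arities F)) (arities-luk-++ F [])

-- Every vertex is either one of the `h` roots or a child of exactly one vertex.
luk-sum : ∀ {h as} → Luk h as → h + sum as ≡ length as
luk-sum []                    = refl
luk-sum (_∷_ {h} {as} a L) = cong suc (begin
  h + (a + sum as) ≡⟨ +-assoc h a (sum as) ⟨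
  h + a + sum as   ≡⟨ cong (_+ sum as) (+-comm h a) ⟩
  a + h + sum as   ≡⟨ luk-sum L ⟩
  length as        ∎)
  where open ≡-Reasoning

-- The bottom tree of the stack

last-∷ : {A : Set} (x : A) (xs : List A) → 0 < length xs → last (x ∷ xs) ≡ last xs
last-∷ x (_ ∷ _) _ = refl

last-drop : {A : Set} (i : ℕ) (xs : List A) → i < length xs → last (drop i xs) ≡ last xs
last-drop zero    xs       _         = refl
last-drop (suc i) (x ∷ xs) (s≤s i<n) =
  trans (last-drop i xs i<n) (sym (last-∷ x xs (≤-<-trans z≤n i<n)))

-- `last` is the bottom of the stack. The height `2 + h` means that some old tree survives below the
-- new root.
last-parse : ∀ {h a as} → Luk (2 + h) (a ∷ as) → last (parse (a ∷ as)) ≡ last (parse as)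
last-parse {h} {a} {as} (a ∷ L) = trans
  (last-∷ _ (drop a (parse as)) (subst (0 <_) (sym (suc-injective (length-parse (a ∷ L)))) z<s))
  (last-drop a (parse as) (subst (a <_) (sym (length-parse L)) (m<m+n a z<s)))

-- Height 1 means that the new root has swallowed the whole stack, so it is itself the bottom, and
-- it has children.
last-parse-root : ∀ {a as} → Luk 1 (suc a ∷ as) → last (parse (suc a ∷ as)) ≢ just singleVertex
last-parse-root {a} {as} L eq
  with drop (suc a) (parse as) | suc-injective (length-parse L) | take (suc a) (parse as) | root-arity L
... | [] | _ | ts | ts≡1+a with () ← trans (sym ts≡1+a) (cong (maybe′ arity 0) eq)

-- Labelled trees and labelled arities

All-labelled : {P : ℕ → ℕ → Set} (s : ℕ) (vs : List Tree) →
  All (uncurry P) (labelFrom s (map arity vs)) → All (λ (s , v) → P s (arity v)) (labelFrom s vs)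
All-labelled s []       []       = []
All-labelled s (v ∷ vs) (p ∷ ps) = p ∷ All-labelled (suc s) vs ps

labelled-All : {P : ℕ → ℕ → Set} (s : ℕ) (vs : List Tree) →
  All (λ (s , v) → P s (arity v)) (labelFrom s vs) → All (uncurry P) (labelFrom s (map arity vs))
labelled-All s []       []       = []
labelled-All s (v ∷ vs) (p ∷ ps) = p ∷ labelled-All (suc s) vs ps

map-filter-labelFrom : {A B C : Set} {P : ℕ → Set} (P? : ∀ s → Dec (P s)) (g : B → C) (f : A → B) →
  ∀ s xs → map (λ (_ , x) → g (f x)) (filter (λ (s , _) → P? s) (labelFrom s xs)) ≡
           map (λ (_ , y) → g y) (filter (λ (s , _) → P? s) (labelFrom s (map f xs)))
map-filter-labelFrom P? g f s []       = refl
map-filter-labelFrom P? g f s (x ∷ xs) with P? s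
... | yes _ = cong (g (f x) ∷_) (map-filter-labelFrom P? g f (suc s) xs)
... | no  _ = map-filter-labelFrom P? g f (suc s) xs

-- Slots and stack heights of path prefixes

module _ (l : ℕ) where

  private
    -- Writing k as `suc l` builds in k ≥ 1; diagonal steps start at heights congruent to `l` modulo
    -- k.
    k = suc l
    K = suc k

  -- Scan p g ρ c: a prefix of a path has been read up to the point p = (x , y),
  -- c lists its slots, the latest one first, and x + g diagonal-or-north slots
  -- are among them, besides the extra 0.  The phase ρ counts the heights entered since the last such
  -- slot, so that y = k (x + g) + pred ρ and the stack has 1 + ρ + (k + 1) g trees.
  data Scan : Point → ℕ → ℕ → List ℕ → Set where
    start : Scan origin 0 0 (0 ∷ [])
    enter : ∀ {p g c} → Scan p g 0 c → Scan p g 1 (0 ∷ c)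
    stepE : ∀ {p g ρ b c} → Scan p (suc g) (suc ρ) (b ∷ c) → Scan (move east p) g (suc ρ) (suc b ∷ c)
    stepN : ∀ {p g ρ c} → ρ < l → Scan p g (suc ρ) c → Scan (move north p) g (suc (suc ρ)) (0 ∷ c)
    wrapN : ∀ {p g c} → Scan p g k c → Scan (move north p) (suc g) 0 (0 ∷ c)
    stepD : ∀ {p g c} → Scan p g k c → Scan (move diagonal p) g 0 (1 ∷ c)

  -- The steps read by the scan, prepended to the steps still to be read.
  word : ∀ {p g ρ c} → Scan p g ρ c → List Step → List Step
  word start       w = w
  word (enter D)   w = word D w
  word (stepE D)   w = word D (east ∷ w)
  word (stepN _ D) w = word D (north ∷ w)
  word (wrapN D)   w = word D (north ∷ w)
  word (stepD D)   w = word D (diagonal ∷ w)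

  -- Phase and latest slot reveal the last constructor. In a positive phase, a positive slot means
  -- `stepE`, and 0 means `enter` or `stepN` according to whether the phase is 1. In phase 0, the
  -- slot tells `wrapN` from `stepD`; `start` stands apart because no scan has an empty list of
  -- slots.
  word-unique : ∀ {p p′ g g′ ρ c} (D : Scan p g ρ c) (D′ : Scan p′ g′ ρ c) →
    word D ≡ word D′
  word-unique start       start        = refl
  word-unique start       (wrapN ())
  word-unique (enter D)   (enter D′)   = word-unique D D′
  word-unique (stepE D)   (stepE D′)   = cong (λ f w → f (east ∷ w)) (word-unique D D′)
  word-unique (stepN _ D) (stepN _ D′) = cong (λ f w → f (north ∷ w)) (word-unique D D′)
  word-unique (wrapN ())  start
  word-unique (wrapN D)   (wrapN D′)   = cong (λ f w → f (north ∷ w)) (word-unique D D′)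
  word-unique (stepD D)   (stepD D′)   = cong (λ f w → f (diagonal ∷ w)) (word-unique D D′)

  scale : List ℕ → List ℕ
  scale = map (_* K)

  phase≤k : ∀ {p g ρ c} → Scan p g ρ c → ρ ≤ k
  phase≤k start         = z≤n
  phase≤k (enter D)     = s≤s z≤n
  phase≤k (stepE D)     = phase≤k D
  phase≤k (stepN ρ<l D) = s≤s ρ<l
  phase≤k (wrapN D)     = z≤n
  phase≤k (stepD D)     = z≤n

  next-line : ∀ q → suc (k * q + l) ≡ k * suc q
  next-line q = begin
    suc (k * q + l) ≡⟨ +-suc (k * q) l ⟨
    k * q + k       ≡⟨ +-comm (k * q) k ⟩
    k + k * q       ≡⟨ *-suc k q ⟨
    k * suc q       ∎
    where open ≡-Reasoning

  -- An east step moves one unit from `g` to `x`, so `x + g` grows only when a multiple of k is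
  -- reached.
  height : ∀ {x y g ρ c} → Scan (x , y) g ρ c → y ≡ k * (x + g) + pred ρ
  height start         = sym (trans (+-identityʳ (k * 0)) (*-zeroʳ k))
  height (enter D)     = height D
  height (stepE {p = x , y} {g} {ρ} D) = trans (height D) (cong (λ q → k * q + ρ) (+-suc x g))
  height (stepN {p = x , y} {g} {ρ} ρ<l D) =
    trans (cong suc (height D)) (sym (+-suc (k * (x + g)) ρ))
  height (wrapN {p = x , y} {g} D) = begin
    suc y                 ≡⟨ cong suc (height D) ⟩
    suc (k * (x + g) + l) ≡⟨ next-line (x + g) ⟩
    k * suc (x + g)       ≡⟨ cong (k *_) (+-suc x g) ⟨
    k * (x + suc g)       ≡⟨ +-identityʳ _ ⟨
    k * (x + suc g) + 0   ∎
    where open ≡-Reasoning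
  height (stepD {p = x , y} {g} D) =
    trans (cong suc (height D)) (trans (next-line (x + g)) (sym (+-identityʳ _)))

  length-scan : ∀ {x y g ρ c} → Scan (x , y) g ρ c → length c ≡ suc ρ + (x + g) * K
  length-scan start         = refl
  length-scan (enter D)     = cong suc (length-scan D)
  length-scan (stepE {p = x , y} {g} {ρ} D) = trans (length-scan D) (cong (λ q → 2 + ρ + q * K) (+-suc x g))
  length-scan (stepN ρ<l D) = cong suc (length-scan D)
  length-scan (wrapN {p = x , y} {g} D) = trans (cong suc (length-scan D)) (cong (λ q → suc (q * K)) (sym (+-suc x g)))
  length-scan (stepD D)     = cong suc (length-scan D)

  -- An east step makes the top vertex pop `K` more trees, paid for by one unit of `g`. A diagonal
  -- step in phase k finds `K + g * K` trees and joins `K` of them under one root.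
  luk : ∀ {p g ρ c} → Scan p g ρ c → Luk (suc ρ + g * K) (scale c)
  luk start       = 0 ∷ []
  luk (enter D)   = 0 ∷ luk D
  luk (stepE {g = g} {ρ} {b} {c} D) with luk D
  ... | _ ∷ L = suc b * K ∷ subst (λ h → Luk h (scale c)) eq L
    where
    eq : b * K + (suc ρ + (K + g * K)) ≡ suc b * K + (suc ρ + g * K)
    eq = begin
      b * K + (suc ρ + (K + g * K))   ≡⟨ cong (b * K +_) (x∙yz≈y∙xz (suc ρ) K (g * K)) ⟩
      b * K + (K + (suc ρ + g * K))   ≡⟨ x∙yz≈yx∙z (b * K) K (suc ρ + g * K) ⟩
      K + b * K + (suc ρ + g * K)     ∎
      where open ≡-Reasoning
  luk (stepN _ D) = 0 ∷ luk D
  luk (wrapN D)   = 0 ∷ luk D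
  luk (stepD {g = g} {c} D) = 1 * K ∷ subst (λ a → Luk (a + g * K) (scale c)) (sym (*-identityˡ K)) (luk D)

  -- Scans and large paths

  above : ∀ {p g ρ c} → Scan p g ρ c → WeaklyAbove k p
  above {x , y} {g} {ρ} D = begin
    k * x                  ≤⟨ *-monoʳ-≤ k (m≤m+n x g) ⟩
    k * (x + g)            ≤⟨ m≤m+n _ _ ⟩
    k * (x + g) + pred ρ   ≡⟨ height D ⟨
    y                      ∎
    where open ≤-Reasoning

  word-endpoint : ∀ {p g ρ c} (D : Scan p g ρ c) w → endpoint origin (word D w) ≡ endpoint p w
  word-endpoint start       w = refl
  word-endpoint (enter D)   w = word-endpoint D w
  word-endpoint (stepE D)   w = word-endpoint D (east ∷ w)
  word-endpoint (stepN _ D) w = word-endpoint D (north ∷ w)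
  word-endpoint (wrapN D)   w = word-endpoint D (north ∷ w)
  word-endpoint (stepD D)   w = word-endpoint D (diagonal ∷ w)

  word-above : ∀ {p g ρ c} (D : Scan p g ρ c) w →
    All (WeaklyAbove k) (points p w) → All (WeaklyAbove k) (points origin (word D w))
  word-above start       w as = as
  word-above (enter D)   w as = word-above D w as
  word-above (stepE D)   w as = word-above D (east ∷ w) (above D ∷ as)
  word-above (stepN _ D) w as = word-above D (north ∷ w) (above D ∷ as)
  word-above (wrapN D)   w as = word-above D (north ∷ w) (above D ∷ as)
  word-above (stepD D)   w as = word-above D (diagonal ∷ w) (above D ∷ as)

  word-diagonals : ∀ {p g ρ c} (D : Scan p g ρ c) w →
    All (AdmissibleDiagonalStart k) (diagonalStarts p w) →
    All (AdmissibleDiagonalStart k) (diagonalStarts origin (word D w))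
  word-diagonals start       w as = as
  word-diagonals (enter D)   w as = word-diagonals D w as
  word-diagonals (stepE D)   w as = word-diagonals D (east ∷ w) as
  word-diagonals (stepN _ D) w as = word-diagonals D (north ∷ w) as
  word-diagonals (wrapN D)   w as = word-diagonals D (north ∷ w) as
  word-diagonals (stepD D)   w as = word-diagonals D (diagonal ∷ w) ((_ , height D) ∷ as)

  word-large : ∀ {n c} (D : Scan (n , k * n) 0 1 c) → IsLargePath k n (word D [])
  word-large D = record
    { ends      = word-endpoint D []
    ; above     = word-above D [] (above D ∷ [])
    ; diagonals = word-diagonals D [] []
    }

  -- Reading the slots off a path

  bump : List ℕ → List ℕ
  bump []      = []
  bump (b ∷ c) = suc b ∷ c

  -- Here `r` is the phase minus one. A step onto a multiple of k pushes two slots at once: the one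
  -- for the step itself and, above it, an empty one for the height just entered.
  codeFrom : ℕ → List ℕ → List Step → List ℕ
  codeFrom r c []             = c
  codeFrom r c (east ∷ w)     = codeFrom r (bump c) w
  codeFrom r c (north ∷ w)    with r <? l
  ... | yes _ = codeFrom (suc r) (0 ∷ c) w
  ... | no  _ = codeFrom 0 (0 ∷ 0 ∷ c) w
  codeFrom r c (diagonal ∷ w) = codeFrom 0 (0 ∷ 1 ∷ c) w

  code : List Step → List ℕ
  code = codeFrom 0 (0 ∷ 0 ∷ [])

  -- The reader never rests in phase 0, so a scan in that phase is met only directly under an
  -- `enter`.
  code-word : ∀ {p g r c} (D : Scan p g (suc r) c) w → code (word D w) ≡ codeFrom r c w
  code-word (enter start)     w = refl
  code-word (enter (wrapN D)) w with l <? l | code-word D (north ∷ w)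
  ... | yes l<l | _  = contradiction l<l (n≮n l)
  ... | no  _   | eq = eq
  code-word (enter (stepD D)) w = code-word D (diagonal ∷ w)
  code-word (stepE D)         w = code-word D (east ∷ w)
  code-word (stepN {ρ = ρ} ρ<l D) w with ρ <? l | code-word D (north ∷ w)
  ... | yes _  | eq = eq
  ... | no ρ≮l | _  = contradiction ρ<l ρ≮l

  points-head : ∀ {P : Point → Set} p w → All P (points p w) → P p
  points-head p []      (h ∷ _) = h
  points-head p (s ∷ w) (h ∷ _) = h

  phase-unique : ∀ q j {r} → r ≤ l → k * q + r ≡ k * j + l → r ≡ l
  phase-unique q j {r} r≤l eq = begin
    r               ≡⟨ m<n⇒m%n≡m (s≤s r≤l) ⟨
    r % k           ≡⟨ [m+kn]%n≡m%n r q k ⟨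
    (r + q * k) % k ≡⟨ cong (_% k) (flip-eq q r) ⟩
    (k * q + r) % k ≡⟨ cong (_% k) eq ⟩
    (k * j + l) % k ≡⟨ cong (_% k) (flip-eq j l) ⟨
    (l + j * k) % k ≡⟨ [m+kn]%n≡m%n l j k ⟩
    l % k           ≡⟨ m<n⇒m%n≡m (n<1+n l) ⟩
    l               ∎
    where
    open ≡-Reasoning
    flip-eq : ∀ q r → r + q * k ≡ k * q + r
    flip-eq q r = trans (+-comm r (q * k)) (cong (_+ r) (*-comm q k))

  -- The path conditions are what the constructors ask for: staying above y = kx provides the unit
  -- of `g` for an east step, and admissibility of a diagonal forces phase k.
  trace : ∀ {p g r c} (D : Scan p g (suc r) c) w →
    All (WeaklyAbove k) (points p w) → All (AdmissibleDiagonalStart k) (diagonalStarts p w) →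
    ∃ λ g′ → ∃ λ r′ → Σ (Scan (endpoint p w) g′ (suc r′) (codeFrom r c w)) λ D′ →
      word D′ [] ≡ word D w
  trace D [] _ _ = _ , _ , D , refl
  trace {c = []} () (east ∷ w) _ _
  trace {g = suc g} {c = b ∷ c} D (east ∷ w) (_ ∷ as) ds = trace (stepE D) w as ds
  -- With no gap left, the height is below k(x + 1), so this east step would end under the line.
  trace {x , y} {g = zero} {r} {c = b ∷ c} D (east ∷ w) (_ ∷ as) ds =
    contradiction (points-head _ w as) (<⇒≱ (begin-strict
      y               ≡⟨ height D ⟩
      k * (x + 0) + r ≡⟨ cong (λ x → k * x + r) (+-identityʳ x) ⟩
      k * x + r       <⟨ +-monoʳ-< (k * x) (phase≤k D) ⟩
      k * x + k       ≡⟨ +-comm (k * x) k ⟩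
      k + k * x       ≡⟨ *-suc k x ⟨
      k * suc x       ∎))
    where open ≤-Reasoning
  trace {r = r} D (north ∷ w) (_ ∷ as) ds with r <? l
  ... | yes r<l = trace (stepN r<l D) w as ds
  ... | no  r≮l with refl ← ≤-antisym (s≤s⁻¹ (phase≤k D)) (≮⇒≥ r≮l) = trace (enter (wrapN D)) w as ds
  trace {x , y} {g} D (diagonal ∷ w) (_ ∷ as) ((j , y≡) ∷ ds)
    with refl ← phase-unique (x + g) j (s≤s⁻¹ (phase≤k D)) (trans (sym (height D)) y≡)
    = trace (enter (stepD D)) w as ds

  -- On the line y = kx the excess kg + r must vanish, which makes the final gap 0 and the final
  -- phase 1.
  height-determines : ∀ n g r → k * n ≡ k * (n + g) + r → g ≡ 0 × r ≡ 0
  height-determines n g r eq = m*n≡0⇒m≡0 g k (m+n≡0⇒m≡0 (g * k) sum≡0) , m+n≡0⇒n≡0 (g * k) sum≡0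
    where
    sum≡0 : g * k + r ≡ 0
    sum≡0 = sym (+-cancelˡ-≡ (k * n) 0 (g * k + r) (begin
      k * n + 0           ≡⟨ +-identityʳ (k * n) ⟩
      k * n               ≡⟨ eq ⟩
      k * (n + g) + r     ≡⟨ cong (_+ r) (*-distribˡ-+ k n g) ⟩
      k * n + k * g + r   ≡⟨ +-assoc (k * n) (k * g) r ⟩
      k * n + (k * g + r) ≡⟨ cong (λ a → k * n + (a + r)) (*-comm k g) ⟩
      k * n + (g * k + r) ∎))
      where open ≡-Reasoning

  scan-path : ∀ {n w} → IsLargePath k n w →
    Σ (Scan (n , k * n) 0 1 (code w)) λ D → word D [] ≡ w
  scan-path {n} {w} L with trace (enter start) w (IsLargePath.above L) (IsLargePath.diagonals L)
  ... | g , r , D with endpoint origin w | IsLargePath.ends L | D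
  ... | _ | refl | D , eq with refl , refl ← height-determines n g r (height D) = D , eq

  -- Labels modulo k + 1

  ValidLabel : ℕ → ℕ → Set
  ValidLabel s a = (CongruentTo1 k s → a ≡ 0 ⊎ a ≡ K) × (¬ CongruentTo1 k s → ∃ λ m → a ≡ m * K)

  -- The slots `c` carry the labels from `s` up to 1 + Kn, and their number is 1 + ρ modulo `K`.
  -- Hence the labels congruent to 1 are exactly those of slots added in phase 0.
  label-residue : ∀ n {s ρ x g} → s + (suc ρ + (x + g) * K) ≡ 2 + K * n → (s + ρ) % K ≡ 1 % K
  label-residue n {s} {ρ} {x} {g} eq = begin
    (s + ρ) % K                 ≡⟨ [m+kn]%n≡m%n (s + ρ) (x + g) K ⟨
    (s + ρ + (x + g) * K) % K   ≡⟨ cong (_% K) (+-assoc s ρ _) ⟩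
    (s + (ρ + (x + g) * K)) % K ≡⟨ cong (_% K) (suc-injective (trans (sym (+-suc s _)) eq)) ⟩
    (1 + K * n) % K             ≡⟨ cong (λ a → (1 + a) % K) (*-comm K n) ⟩
    (1 + n * K) % K             ≡⟨ [m+kn]%n≡m%n 1 n K ⟩
    1 % K                       ∎
    where open ≡-Reasoning

  label≡1 : ∀ n {p s g c} → Scan p g 0 c → s + length c ≡ 2 + K * n → CongruentTo1 k s
  label≡1 n {x , y} {s} {g} D eq = begin
    s % K       ≡⟨ cong (_% K) (+-identityʳ s) ⟨
    (s + 0) % K ≡⟨ label-residue n {s} {0} {x} {g} (trans (cong (s +_) (sym (length-scan D))) eq) ⟩
    1 % K       ∎
    where open ≡-Reasoning

  -- Otherwise the phase would be 0 modulo `K`, yet it lies between 1 and k.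
  label≢1 : ∀ n {p s g ρ c} → Scan p g (suc ρ) c → s + length c ≡ 2 + K * n → ¬ CongruentTo1 k s
  label≢1 n {x , y} {s} {g} {ρ} D eq s≡1 = absurd (m≤n⇒m<n∨m≡n (phase≤k D))
    where
    residue : (2 + ρ) % K ≡ 1
    residue = begin
      (2 + ρ) % K                 ≡⟨ %-distribˡ-+ 1 (suc ρ) K ⟩
      (1 % K + suc ρ % K) % K     ≡⟨ cong (λ a → (a + suc ρ % K) % K) s≡1 ⟨
      (s % K + suc ρ % K) % K     ≡⟨ %-distribˡ-+ s (suc ρ) K ⟨
      (s + suc ρ) % K             ≡⟨ label-residue n {s} {suc ρ} {x} {g} (trans (cong (s +_) (sym (length-scan D))) eq) ⟩
      1                           ∎
      where open ≡-Reasoning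
    absurd : ¬ (suc ρ < k ⊎ suc ρ ≡ k)
    absurd (inj₁ ρ<k)  = contradiction (trans (sym (m<n⇒m%n≡m (s≤s ρ<k))) residue) λ ()
    absurd (inj₂ refl) = contradiction (trans (sym (n%n≡0 K)) residue) λ ()

  tail-label : ∀ {n} s (c : List ℕ) → s + suc (length c) ≡ n → suc s + length c ≡ n
  tail-label s c eq = trans (sym (+-suc s (length c))) eq

  labels-valid : ∀ n {p g ρ c} s → Scan p g ρ c → s + length c ≡ 2 + K * n →
    All (uncurry ValidLabel) (labelFrom s (scale c))
  labels-valid n s start eq = ((λ _ → inj₁ refl) , (λ _ → 0 , refl)) ∷ []
  labels-valid n s (enter {c = c} D) eq =
    ((λ _ → inj₁ refl) , (λ _ → 0 , refl)) ∷ labels-valid n (suc s) D (tail-label s c eq)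
  -- Only the head slot changes, so the labels below keep their validity and the head is checked
  -- anew.
  labels-valid n s (stepE {b = b} D) eq with labels-valid n s D eq
  ... | _ ∷ vs = ((λ s≡1 → contradiction s≡1 (label≢1 n D eq)) , (λ _ → suc b , refl)) ∷ vs
  labels-valid n s (stepN {c = c} _ D) eq =
    ((λ _ → inj₁ refl) , (λ _ → 0 , refl)) ∷ labels-valid n (suc s) D (tail-label s c eq)
  labels-valid n s (wrapN {c = c} D) eq =
    ((λ _ → inj₁ refl) , (λ _ → 0 , refl)) ∷ labels-valid n (suc s) D (tail-label s c eq)
  labels-valid n s (stepD {c = c} D) eq =
    ((λ _ → inj₂ (*-identityˡ K)) , (λ _ → 1 , refl)) ∷ labels-valid n (suc s) D (tail-label s c eq)

  -- The forest of a path

  toForest : List Step → Forest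
  toForest w = parse (scale (code w))

  length-code : ∀ n {c} → Scan (n , k * n) 0 1 c → length c ≡ 2 + K * n
  length-code n D = begin
    _               ≡⟨ length-scan D ⟩
    2 + (n + 0) * K ≡⟨ cong (λ a → 2 + a * K) (+-identityʳ n) ⟩
    2 + n * K       ≡⟨ cong (2 +_) (*-comm n K) ⟩
    2 + K * n       ∎
    where open ≡-Reasoning

  scan-valid : ∀ n {c} → Scan (n , k * n) 0 1 c → IsValidForest k n (parse (scale c))
  scan-valid n {c} D = record
    { vertices = #vertices
    ; edges    = suc-injective (suc-injective (begin
        2 + sum (arities F)  ≡⟨ cong (λ as → 2 + sum as) arities-F ⟩
        2 + sum (scale c)    ≡⟨ luk-sum (luk D) ⟩
        length (scale c)     ≡⟨ length-map (_* K) c ⟩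
        length c             ≡⟨ length-code n D ⟩
        2 + K * n            ∎))
    ; twoTrees = length-parse (luk D)
    ; label≡1  = All.map proj₁ valid
    ; label≢1  = All.map proj₂ valid
    }
    where
    open ≡-Reasoning
    F = parse (scale c)
    arities-F : arities F ≡ scale c
    arities-F = arities-parse (luk D)
    #vertices : length (preorder F) ≡ 2 + K * n
    #vertices = begin
      length (preorder F) ≡⟨ length-map arity (preorder F) ⟨
      length (arities F)  ≡⟨ cong length arities-F ⟩
      length (scale c)    ≡⟨ length-map (_* K) c ⟩
      length c            ≡⟨ length-code n D ⟩
      2 + K * n           ∎
    valid = All-labelled {ValidLabel} 0 (preorder F)
      (subst (λ as → All (uncurry ValidLabel) (labelFrom 0 as)) (sym arities-F)
        (labels-valid n 0 D (length-code n D)))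

  -- From valid forests back to scans

  record Decoded (h : ℕ) (as : List ℕ) : Set where
    constructor decoded
    field
      {x y gap phase} : ℕ
      {slots}         : List ℕ
      as≡             : as ≡ scale slots
      h≡              : h ≡ suc phase + gap * K
      scan            : Scan (x , y) gap phase slots

  push : ∀ {x y g ρ c} → ρ < k → Scan (x , y) g ρ c → ∃ λ y′ → Scan (x , y′) g (suc ρ) (0 ∷ c)
  push {ρ = zero}  _         D = _ , enter D
  push {ρ = suc ρ} (s≤s ρ<l) D = _ , stepN ρ<l D

  steps : ∀ b {x y g ρ c} → Scan (x , y) (b + g) (suc ρ) (0 ∷ c) →
    ∃ λ x′ → Scan (x′ , y) g (suc ρ) (b ∷ c)
  steps zero            D = _ , D
  steps (suc b) {x} {y} {g} {ρ} {c} D =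
    _ , stepE (proj₂ (steps b (subst (λ a → Scan (x , y) a (suc ρ) (0 ∷ c)) (sym (+-suc b g)) D)))

  -- The stack holds fewer than (g + 1)K trees. So enough trees for a vertex with bK children means
  -- enough gap for b east steps.
  gap-bound : ∀ {b m ρ g} → ρ < k → b * K + m ≡ suc ρ + g * K → b ≤ g
  gap-bound {b} {m} {ρ} {g} ρ<k eq = s≤s⁻¹ (*-cancelʳ-< K b (suc g) (begin-strict
    b * K         ≤⟨ m≤m+n (b * K) m ⟩
    b * K + m     ≡⟨ eq ⟩
    suc ρ + g * K <⟨ +-monoˡ-< (g * K) (s≤s ρ<k) ⟩
    K + g * K     ∎))
    where open ≤-Reasoning

  -- The phase of the decoded tail says which kind of slot comes next, and it also fixes the label
  -- modulo `K`; the arity condition for that label then admits only arities that a constructor can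
  -- produce.
  decode : ∀ n {h} s as → as ≢ [] → Luk h as → s + length as ≡ 2 + K * n →
    All (uncurry ValidLabel) (labelFrom s as) → Decoded h as
  decode n s []       ne _ _ _ = contradiction refl ne
  decode n s (a ∷ []) _ (_∷_ {h} a L) _ _ with a | h | L
  -- The last vertex in pre-order finds an empty stack, so its arity is 0: this is the extra slot of
  -- `start`.
  ... | zero | zero | [] = decoded refl refl start
  decode n s (a ∷ as@(_ ∷ _)) _ (_∷_ {m} a L) eq ((v₁ , v₂) ∷ vs)
    with decode n (suc s) as (λ ()) L (tail-label s as eq) vs
  ... | decoded {x} {y} {g} {ρ} {c} as≡ h≡ D with m≤n⇒m<n∨m≡n (phase≤k D)
  -- The label depends only on the phase and the number of slots, so a provisional empty slot
  -- suffices to compute it.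
  ...   | inj₁ ρ<k = slot (v₂ (label≢1 n (proj₂ (push ρ<k D)) len))
    where
    len : s + suc (length c) ≡ 2 + K * n
    len = trans (cong (λ i → s + suc i) (sym (trans (cong length as≡) (length-map (_* K) c)))) eq
    slot : (∃ λ b → a ≡ b * K) → Decoded (suc m) (a ∷ as)
    slot (b , refl) with m≤n⇒∃[o]m+o≡n (gap-bound {b} {m} {ρ} {g} ρ<k h≡)
    ... | g′ , refl = decoded (cong (b * K ∷_) as≡) (cong suc m≡)
                        (proj₂ (steps b (proj₂ (push ρ<k D))))
      where
      m≡ : m ≡ suc ρ + g′ * K
      m≡ = +-cancelˡ-≡ (b * K) m (suc ρ + g′ * K) (begin
        b * K + m                ≡⟨ h≡ ⟩
        suc ρ + (b + g′) * K     ≡⟨ cong (suc ρ +_) (*-distribʳ-+ K b g′) ⟩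
        suc ρ + (b * K + g′ * K) ≡⟨ x∙yz≈y∙xz (suc ρ) (b * K) (g′ * K) ⟩
        b * K + (suc ρ + g′ * K) ∎)
        where open ≡-Reasoning
  ...   | inj₂ refl = slot (v₁ (label≡1 n (wrapN D) len))
    where
    len : s + suc (length c) ≡ 2 + K * n
    len = trans (cong (λ i → s + suc i) (sym (trans (cong length as≡) (length-map (_* K) c)))) eq
    slot : a ≡ 0 ⊎ a ≡ K → Decoded (suc m) (a ∷ as)
    slot (inj₁ refl) = decoded (cong (0 ∷_) as≡) (cong suc h≡) (wrapN D)
    slot (inj₂ refl) = decoded (cong₂ _∷_ (sym (*-identityˡ K)) as≡)
                         (cong suc (+-cancelˡ-≡ K m (g * K) h≡)) (stepD D)

  valid-scan : ∀ {n F} → IsValidForest k n F →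
    ∃ λ c → Scan (n , k * n) 0 1 c × parse (scale c) ≡ F
  valid-scan {n} {F} V
    with decode n 0 (arities F) ne (subst (λ h → Luk h (arities F)) twoTrees (arities-luk F)) len
           (labelled-All {ValidLabel} 0 (preorder F) (All.zip (label≡1′ , label≢1′)))
    where
    open IsValidForest V renaming (label≡1 to label≡1′; label≢1 to label≢1′)
    len : length (arities F) ≡ 2 + K * n
    len = trans (length-map arity (preorder F)) vertices
    ne : arities F ≢ []
    ne eq with () ← trans (sym len) (cong length eq)
  -- Two trees on the stack mean 2 = 1 + phase + gap · K. As K ≥ 2, only gap 0 and phase 1 remain;
  -- the vertex count then gives `x`, and the height gives `y`.
  ... | decoded {x} {y} {zero} {suc zero} {c} as≡ refl D = c , subst (λ p → Scan p 0 1 c) p≡ D , (begin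
      parse (scale c)   ≡⟨ cong parse as≡ ⟨
      parse (arities F) ≡⟨ parse-arities F ⟩
      F                 ∎)
    where
    open ≡-Reasoning
    x≡n : x ≡ n
    x≡n = *-cancelʳ-≡ x n K (suc-injective (suc-injective (begin
      2 + x * K                ≡⟨ cong (λ a → 2 + a * K) (+-identityʳ x) ⟨
      2 + (x + 0) * K          ≡⟨ length-scan D ⟨
      length c                 ≡⟨ length-map (_* K) c ⟨
      length (scale c)         ≡⟨ cong length as≡ ⟨
      length (arities F)       ≡⟨ length-map arity (preorder F) ⟩
      length (preorder F)      ≡⟨ IsValidForest.vertices V ⟩
      2 + K * n                ≡⟨ cong (2 +_) (*-comm K n) ⟩
      2 + n * K                ∎)))
    p≡ : (x , y) ≡ (n , k * n)
    p≡ = cong₂ _,_ x≡n (begin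
      y               ≡⟨ height D ⟩
      k * (x + 0) + 0 ≡⟨ +-identityʳ _ ⟩
      k * (x + 0)     ≡⟨ cong (k *_) (trans (+-identityʳ x) x≡n) ⟩
      k * n           ∎)
  ... | decoded {gap = zero} {zero} _ () D
  ... | decoded {gap = suc g} {zero} _ () D
  ... | decoded {gap = suc g} {suc ρ} _ eq D
    with () ← trans (suc-injective eq) (cong suc (trans (+-suc ρ (k + g * K)) (cong suc (+-suc ρ (l + g * K)))))

  parse-scale-injective : ∀ {p q g h ρ σ c d} → Scan p g ρ c → Scan q h σ d →
    parse (scale c) ≡ parse (scale d) → c ≡ d
  parse-scale-injective {c = c} {d} D E eq = map-injective (λ {a} {b} → *-cancelʳ-≡ a b K) (begin
    scale c                   ≡⟨ arities-parse (luk D) ⟨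
    arities (parse (scale c)) ≡⟨ cong arities eq ⟩
    arities (parse (scale d)) ≡⟨ arities-parse (luk E) ⟩
    scale d                   ∎)
    where open ≡-Reasoning

  -- Types

  otherLabel? : (s : ℕ) → Dec (¬ CongruentTo1 k s)
  otherLabel? s = ¬? (s % K ≟ 1 % K)

  quotients : List (ℕ × ℕ) → List ℕ
  quotients ps = filter (0 <?_) (map (λ (s , a) → a / K) (filter (λ (s , a) → otherLabel? s) ps))

  parts : ℕ → List ℕ → List ℕ
  parts s as = quotients (labelFrom s as)

  forestType-parts : ∀ F → forestType k F ≡ parts 0 (arities F)
  forestType-parts F = cong (filter (0 <?_)) (map-filter-labelFrom otherLabel? (_/ K) arity 0 (preorder F))

  parts-skip : ∀ {s} → CongruentTo1 k s → ∀ a as → parts s (a ∷ as) ≡ parts (suc s) as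
  parts-skip {s} s≡1 a as = cong (λ ps → filter (0 <?_) (map (λ ((s , a) : ℕ × ℕ) → a / K) ps))
    (filter-reject (λ (s , a) → otherLabel? s) {x = s , a} {xs = labelFrom (suc s) as} (λ s≢1 → s≢1 s≡1))

  -- `eastRunsFrom b []` serves as the list that contains `b` if `b` is positive and is empty
  -- otherwise.
  parts-keep : ∀ {s} → ¬ CongruentTo1 k s → ∀ b as →
    parts s (b * K ∷ as) ≡ eastRunsFrom b [] ++ parts (suc s) as
  parts-keep {s} s≢1 b as = trans
    (cong (λ ps → filter (0 <?_) (map (λ ((s , a) : ℕ × ℕ) → a / K) ps))
      (filter-accept (λ (s , a) → otherLabel? s) {x = s , b * K} {xs = labelFrom (suc s) as} s≢1))
    (trans (cong (λ a → filter (0 <?_) (a ∷ rest)) (m*n/n≡m b K)) (positive b))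
    where
    rest = map (λ (s , a) → a / K) (filter (λ (s , a) → otherLabel? s) (labelFrom (suc s) as))
    positive : ∀ b → filter (0 <?_) (b ∷ rest) ≡ eastRunsFrom b [] ++ filter (0 <?_) rest
    positive zero    = refl
    positive (suc b) = refl

  open-run : ∀ b {t} w → t ≢ east → eastRunsFrom b (t ∷ w) ≡ eastRunsFrom b [] ++ eastRunsFrom 0 w
  open-run b       {east}     w t≢ = contradiction refl t≢
  open-run zero    {north}    w t≢ = refl
  open-run zero    {diagonal} w t≢ = refl
  open-run (suc b) {north}    w t≢ = refl
  open-run (suc b) {diagonal} w t≢ = refl

  -- Slots are listed latest first and runs earliest first, whence `↭`. In a positive phase the top
  -- slot is the run still open (`runs₊`), and a step other than east turns it into a part
  -- (`close`). Slots added in phase 0 are skipped by their labels, so the 1 of a diagonal is not a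
  -- part.
  runs₀ : ∀ n {p g c} s (D : Scan p g 0 c) → s + length c ≡ 2 + K * n → ∀ w →
    eastRunsFrom 0 (word D w) ↭ eastRunsFrom 0 w ++ parts s (scale c)
  runs₊ : ∀ n {p g ρ b c} s (D : Scan p g (suc ρ) (b ∷ c)) → s + length (b ∷ c) ≡ 2 + K * n → ∀ w →
    eastRunsFrom 0 (word D w) ↭ eastRunsFrom b w ++ parts (suc s) (scale c)
  close : ∀ n {p g ρ c} s (D : Scan p g (suc ρ) c) → s + length c ≡ 2 + K * n → ∀ {t} w → t ≢ east →
    eastRunsFrom 0 (word D (t ∷ w)) ↭ eastRunsFrom 0 w ++ parts s (scale c)
  close n {c = []} s () eq w t≢
  close n {c = b ∷ c} s D eq {t} w t≢ = begin
    eastRunsFrom 0 (word D (t ∷ w))    ↭⟨ runs₊ n s D eq (t ∷ w) ⟩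
    eastRunsFrom b (t ∷ w) ++ U        ≡⟨ cong (_++ U) (open-run b w t≢) ⟩
    (R ++ W) ++ U                      ↭⟨ ++⁺ʳ U (++-comm R W) ⟩
    (W ++ R) ++ U                      ≡⟨ ++-assoc W R U ⟩
    W ++ R ++ U                        ≡⟨ cong (W ++_) (parts-keep (label≢1 n D eq) b (scale c)) ⟨
    W ++ parts s (scale (b ∷ c))           ∎
    where
    open PermutationReasoning
    R = eastRunsFrom b []
    W = eastRunsFrom 0 w
    U = parts (suc s) (scale c)
  runs₀ n s start     eq w rewrite parts-skip {s} (label≡1 n start eq) 0 [] = ↭-reflexive (sym (++-identityʳ _))
  runs₀ n s (wrapN {c = c} D) eq w rewrite parts-skip {s} (label≡1 n (wrapN D) eq) 0 (scale c) =
    close n (suc s) D (tail-label s c eq) w (λ ())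
  runs₀ n s (stepD {c = c} D) eq w rewrite parts-skip {s} (label≡1 n (stepD D) eq) (1 * K) (scale c) =
    close n (suc s) D (tail-label s c eq) w (λ ())
  runs₊ n s (enter {c = c} D)   eq w = runs₀ n (suc s) D (tail-label s c eq) w
  runs₊ n s (stepE {c = c} D)   eq w = runs₊ n s D eq (east ∷ w)
  runs₊ n s (stepN {c = c} _ D) eq w = close n (suc s) D (tail-label s c eq) w (λ ())

  scan-type : ∀ n {c} (D : Scan (n , k * n) 0 1 c) → pathType (word D []) ↭ forestType k (parse (scale c))
  scan-type n {[]} ()
  scan-type n {b ∷ c} D = begin
    pathType (word D [])                     ↭⟨ runs₊ n 0 D len [] ⟩
    eastRunsFrom b [] ++ parts 1 (scale c)       ≡⟨ parts-keep (label≢1 n {s = 0} D len) b (scale c) ⟨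
    parts 0 (scale (b ∷ c))                      ≡⟨ cong (parts 0) (arities-parse (luk D)) ⟨
    parts 0 (arities (parse (scale (b ∷ c))))    ≡⟨ forestType-parts (parse (scale (b ∷ c))) ⟨
    forestType k (parse (scale (b ∷ c)))     ∎
    where
    open PermutationReasoning
    len = length-code n D

  -- Small paths and paths ending with a diagonal step

  SmallFrom : Point → List Step → Set
  SmallFrom p w = All (λ p → ¬ DiagonalTouches k p) (diagonalStarts p w)

  BottomIsSingle : List ℕ → Set
  BottomIsSingle c = last (parse (scale c)) ≡ just singleVertex

  bottom-∷ : ∀ {h b c} {A : Set} → Luk (2 + h) (b * K ∷ scale c) → (A × BottomIsSingle c) ⇔ (A × BottomIsSingle (b ∷ c))
  bottom-∷ L = mk⇔ (map₂ (trans (last-parse L))) (map₂ (trans (sym (last-parse L))))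

  -- In phase k a diagonal ends at height k(x + g + 1), to be compared with k(x + 1). It can start
  -- on the line only if k = 1; both cases yield k(x + g) ≤ kx.
  touches⇒gap≡0 : ∀ {x y g c} → Scan (x , y) g k c → DiagonalTouches k (x , y) → g ≡ 0
  touches⇒gap≡0 {x} {y} {g} D touch = n≤0⇒n≡0 (+-cancelˡ-≤ x g 0 (begin
    x + g ≤⟨ *-cancelˡ-≤ k (below touch) ⟩
    x     ≡⟨ +-identityʳ x ⟨
    x + 0 ∎))
    where
    open ≤-Reasoning
    below : DiagonalTouches k (x , y) → k * (x + g) ≤ k * x
    below (inj₁ y≡) = begin
      k * (x + g)     ≤⟨ m≤m+n _ l ⟩
      k * (x + g) + l ≡⟨ height D ⟨
      y               ≡⟨ y≡ ⟩
      k * x           ∎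
    below (inj₂ y≡) = +-cancelˡ-≤ k _ _ (begin
      k + k * (x + g)       ≡⟨ *-suc k (x + g) ⟨
      k * suc (x + g)       ≡⟨ next-line (x + g) ⟨
      suc (k * (x + g) + l) ≡⟨ cong suc (height D) ⟨
      suc y                 ≡⟨ y≡ ⟩
      k * suc x             ≡⟨ *-suc k x ⟩
      k + k * x             ∎)

  gap≡0⇒touches : ∀ {x y c} → Scan (x , y) 0 k c → DiagonalTouches k (x , y)
  gap≡0⇒touches {x} {y} D = inj₂ (begin
    suc y                 ≡⟨ cong suc (height D) ⟩
    suc (k * (x + 0) + l) ≡⟨ next-line (x + 0) ⟩
    k * suc (x + 0)       ≡⟨ cong (λ x → k * suc x) (+-identityʳ x) ⟩
    k * suc x             ∎)
    where open ≡-Reasoning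

  -- A diagonal touches the line exactly when the gap is 0, and exactly then it swallows the whole
  -- stack. After any other step at least two trees remain, so the bottom is unchanged.
  small⇔bottom : ∀ {p g ρ c} (D : Scan p g ρ c) w →
    SmallFrom origin (word D w) ⇔ (SmallFrom p w × BottomIsSingle c)
  small⇔bottom start w = mk⇔ (_, refl) proj₁
  small⇔bottom (enter {c = c} D) w = small⇔bottom D w ⟨∘⟩ bottom-∷ {b = 0} {c} (luk (enter D))
  small⇔bottom (stepE {b = b} {c} D) w =
    -- The old and the new top vertex are compared through the stack of `c`, whose bottom survives
    -- under both.
    small⇔bottom D (east ∷ w) ⟨∘⟩ (⇔-sym (bottom-∷ {b = b} {c} (luk D)) ⟨∘⟩ bottom-∷ {b = suc b} {c} (luk (stepE D)))
  small⇔bottom (stepN {c = c} ρ<l D) w = small⇔bottom D (north ∷ w) ⟨∘⟩ bottom-∷ {b = 0} {c} (luk (stepN ρ<l D))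
  small⇔bottom (wrapN {c = c} D) w = small⇔bottom D (north ∷ w) ⟨∘⟩ bottom-∷ {b = 0} {c} (luk (wrapN D))
  -- Both sides are false here, and remain so whatever follows.
  small⇔bottom (stepD {g = zero} {c} D) w = small⇔bottom D (diagonal ∷ w) ⟨∘⟩ mk⇔
    (λ { (¬t ∷ _ , _) → contradiction (gap≡0⇒touches D) ¬t })
    (λ { (_ , bottom) → contradiction bottom (last-parse-root (luk (stepD D))) })
  small⇔bottom (stepD {g = suc g} {c} D) w = small⇔bottom D (diagonal ∷ w) ⟨∘⟩ (mk⇔
    (λ { (_ ∷ ss , bottom) → ss , bottom })
    (λ { (ss , bottom) → (λ touch → contradiction (touches⇒gap≡0 D touch) λ ()) ∷ ss , bottom })
    ⟨∘⟩ bottom-∷ {b = 1} {c} (luk (stepD D)))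

  scan-small : ∀ {n c} (D : Scan (n , k * n) 0 1 c) →
    IsSmall k (word D []) ⇔ SecondTreeIsSingleVertex (parse (scale c))
  scan-small {n} {c} D = small⇔bottom D [] ⟨∘⟩ second (parse (scale c)) (length-parse (luk D))
    where
    second : ∀ F → length F ≡ 2 →
      (SmallFrom (n , k * n) [] × last F ≡ just singleVertex) ⇔ SecondTreeIsSingleVertex F
    second (t ∷ u ∷ []) refl = mk⇔ (λ { (_ , refl) → t , refl }) (λ { (_ , refl) → [] , refl })

  word-++ : ∀ {p g ρ c} (D : Scan p g ρ c) v w → word D (v ++ w) ≡ word D v ++ w
  word-++ start       v w = refl
  word-++ (enter D)   v w = word-++ D v w
  word-++ (stepE D)   v w = word-++ D (east ∷ v) w
  word-++ (stepN _ D) v w = word-++ D (north ∷ v) w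
  word-++ (wrapN D)   v w = word-++ D (north ∷ v) w
  word-++ (stepD D)   v w = word-++ D (diagonal ∷ v) w

  -- The top slot is the arity of the first root. If it is 0, the height was just entered, and by a
  -- diagonal, since `wrapN` leaves a positive gap. If it is positive, the last step is east.
  scan-last : ∀ {n} .{{_ : NonZero n}} {y c} (D : Scan (n , y) 0 1 c) →
    EndsWithDiagonal (word D []) ⇔ FirstTreeIsSingleVertex (parse (scale c))
  scan-last (enter start) = contradiction refl (≢-nonZero⁻¹ 0)
  scan-last (enter (stepD {c = c} D)) = mk⇔
    (λ _ → first (parse (scale (1 ∷ c))) (suc-injective (length-parse (luk (enter (stepD D))))))
    (λ _ → word D [] , word-++ D [] (diagonal ∷ []))
    where
    first : ∀ F → length F ≡ 1 → FirstTreeIsSingleVertex (singleVertex ∷ F)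
    first (t ∷ []) refl = t , refl
  scan-last (stepE {b = b} {c} D) = mk⇔
    (λ { (v , eq) → contradiction (∷ʳ-injectiveʳ (word D []) v (trans (sym (word-++ D [] (east ∷ []))) eq)) λ () })
    (λ { (t , eq) → contradiction
      (trans (sym (root-arity (luk (stepE D)))) (cong arity (∷-injectiveˡ eq))) λ () })

-- Assembly of the bijection and its properties

mainTheorem2 : (k : ℕ) .{{_ : NonZero k}} (n : ℕ) .{{_ : NonZero n}} →
    Σ (Bijection (LargePaths k n) (ValidForests k n)) λ φ →
    let open Bijection φ using (to) in
    ((p : Setoid.Carrier (LargePaths k n)) →
    pathType (proj₁ p) ↭ forestType k (proj₁ (to p)))
    × ((p : Setoid.Carrier (LargePaths k n)) →
    IsSmall k (proj₁ p) ⇔ SecondTreeIsSingleVertex (proj₁ (to p)))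
    × ((p : Setoid.Carrier (LargePaths k n)) →
    EndsWithDiagonal (proj₁ p) ⇔ FirstTreeIsSingleVertex (proj₁ (to p)))
mainTheorem2 (suc l) n = φ , type , small , ends
  where
  k = suc l

  to : ∃ (IsLargePath k n) → ∃ (IsValidForest k n)
  to (w , L) = toForest l w , scan-valid l n (proj₁ (scan-path l L))

  -- The forest returns its arities, hence the slots, and these spell only one word.
  injective : ∀ {p q : ∃ (IsLargePath k n)} → toForest l (proj₁ p) ≡ toForest l (proj₁ q) → proj₁ p ≡ proj₁ q
  injective {v , L} {w , M} eq with code l v | scan-path l L | code l w | scan-path l M
  ... | c | D , refl | d | E , refl
    with refl ← parse-scale-injective l D E eq = cong (λ f → f []) (word-unique l D E)

  surjective : (F : ∃ (IsValidForest k n)) → Σ (∃ (IsLargePath k n)) λ p →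
    ∀ {q : ∃ (IsLargePath k n)} → proj₁ q ≡ proj₁ p → toForest l (proj₁ q) ≡ proj₁ F
  -- The preimage is the word of the decoded scan; by `code-word`, reading it yields the slots `c`
  -- again.
  surjective (F , V) with c , D , eq ← valid-scan l V =
    (word l D [] , word-large l D) , λ w≡ →
      trans (cong (toForest l) w≡) (trans (cong (λ c → parse (scale l c)) (code-word l D [])) eq)

  φ : Bijection (LargePaths k n) (ValidForests k n)
  φ = record
    { to        = to
    ; cong      = cong (toForest l)
    ; bijective = (λ {p} {q} → injective {p} {q}) , surjective
    }

  type : ∀ p → pathType (proj₁ p) ↭ forestType k (toForest l (proj₁ p))
  type (w , L) with D , eq ← scan-path l L =
    subst (λ v → pathType v ↭ forestType k (toForest l w)) eq (scan-type l n D)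

  small : ∀ p → IsSmall k (proj₁ p) ⇔ SecondTreeIsSingleVertex (toForest l (proj₁ p))
  small (w , L) with D , eq ← scan-path l L =
    subst (λ v → IsSmall k v ⇔ SecondTreeIsSingleVertex (toForest l w)) eq (scan-small l D)

  ends : ∀ p → EndsWithDiagonal (proj₁ p) ⇔ FirstTreeIsSingleVertex (toForest l (proj₁ p))
  ends (w , L) with D , eq ← scan-path l L =
    subst (λ v → EndsWithDiagonal v ⇔ FirstTreeIsSingleVertex (toForest l w)) eq (scan-last l D)
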